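{- Let $L(\mathrm{CFG})$ be the class of posets isomorphic to the configuration space of some convergent Chip Firing Game, and $L(\mathrm{ASM})$ the class of posets isomorphic to the configuration space of some convergent Abelian Sandpile Model. Then $L(\mathrm{ASM})\subsetneq L(\mathrm{CFG})$.
   Context: A Chip Firing Game (CFG) is played on a finite directed multigraph with an initial configuration $\sigma_0:V\to\mathbb{N}$ of chips. A vertex $v$ with at least one outgoing edge and at least $d^+(v)$ chips may be fired, sending one chip along each outgoing edge. An Abelian Sandpile Model (ASM) is the same game played on a finite undirected multigraph with a distinguished vertex $\bot$ (the sink) that is never fired. A vertex $v\neq\bot$ holding at least as many chips as its degree may be fired, sending one chip along each incident edge. For either game, the configuration space is the set of configurations reachable from the initial configuration, ordered by reachability. A game is convergent if it reaches a final configuration in which no firing is possible. -}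

module Defs where

open import Level using (0ℓ)
open import Data.Nat using (ℕ; _+_; _∸_; _≤_)
open import Data.Fin using (Fin; _≟_)
open import Data.Vec using (Vec; lookup; tabulate; sum)
open import Data.Product using (Σ; ∃; _×_; proj₁; _,_)
open import Relation.Nullary using (¬_; yes; no)
open import Relation.Binary.PropositionalEquality using (_≡_; _≢_)
open import Relation.Binary.Bundles using (Poset)
open import Relation.Binary.Construct.Closure.ReflexiveTransitive using (Star)

-- Multigraphs on the vertex set Fin n, given by edge multiplicities.
-- m v w = number of edges from v to w.

Config : ℕ → Set
Config n = Vec ℕ n

outdeg : ∀ {n} → (Fin n → Fin n → ℕ) → Fin n → ℕ
outdeg m v = sum (tabulate (m v))

fire : ∀ {n} → (Fin n → Fin n → ℕ) → Fin n → Config n → Config n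
fire {n} m v σ = tabulate f
  where
  f : Fin n → ℕ
  f w with v ≟ w
  ... | yes _ = (lookup σ w + m v w) ∸ outdeg m v
  ... | no  _ = lookup σ w + m v w

record CFG : Set where
  field
    n      : ℕ
    edges  : Fin n → Fin n → ℕ
    noLoop : ∀ v → edges v v ≡ 0
    init   : Config n

CFGStep : (G : CFG) → Config (CFG.n G) → Config (CFG.n G) → Set
CFGStep G σ σ′ = ∃ λ v →
  (1 ≤ outdeg (CFG.edges G) v) ×
  (outdeg (CFG.edges G) v ≤ lookup σ v) ×
  (σ′ ≡ fire (CFG.edges G) v σ)

record ASM : Set where
  field
    n      : ℕ
    edges  : Fin n → Fin n → ℕ
    symm   : ∀ v w → edges v w ≡ edges w v
    noLoop : ∀ v → edges v v ≡ 0
    sink   : Fin n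
    init   : Config n

ASMStep : (A : ASM) → Config (ASM.n A) → Config (ASM.n A) → Set
ASMStep A σ σ′ = ∃ λ v →
  (v ≢ ASM.sink A) ×
  (outdeg (ASM.edges A) v ≤ lookup σ v) ×
  (σ′ ≡ fire (ASM.edges A) v σ)

module _ {n : ℕ} (Step : Config n → Config n → Set) (σ₀ : Config n) where

  Reach : Config n → Config n → Set
  Reach = Star Step

  Convergent : Set
  Convergent = ∃ λ σ → Reach σ₀ σ × (∀ σ′ → ¬ Step σ σ′)

  Space : Set
  Space = Σ (Config n) (λ σ → Reach σ₀ σ)

  _≤S_ : Space → Space → Set
  x ≤S y = Reach (proj₁ x) (proj₁ y)

  _≈S_ : Space → Space → Set
  x ≈S y = proj₁ x ≡ proj₁ y

  record _≅Space (P : Poset 0ℓ 0ℓ 0ℓ) : Set where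
    open Poset P renaming (Carrier to C; _≤_ to _⊑_)
    field
      to        : C → Space
      from      : Space → C
      to-cong   : ∀ {x y} → x ≈ y → to x ≈S to y
      from-cong : ∀ {x y} → x ≈S y → from x ≈ from y
      from-to   : ∀ x → from (to x) ≈ x
      to-from   : ∀ s → to (from s) ≈S s
      to-mono   : ∀ {x y} → x ⊑ y → to x ≤S to y
      to-refl   : ∀ {x y} → to x ≤S to y → x ⊑ y

InLCFG : Poset 0ℓ 0ℓ 0ℓ → Set
InLCFG P = Σ CFG λ G →
  Convergent (CFGStep G) (CFG.init G) × _≅Space (CFGStep G) (CFG.init G) P

InLASM : Poset 0ℓ 0ℓ 0ℓ → Set
InLASM P = Σ ASM λ A →
  Convergent (ASMStep A) (ASM.init A) × _≅Space (ASMStep A) (ASM.init A) P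

{-# OPTIONS --safe #-}

-- Deleting the edges that leave the sink turns an ASM into a CFG with the same moves.
--
-- For strictness, the order determines the moves (they are the covering pairs), and it
-- determines which moves are firings of the same vertex: a firing that stays available
-- along a path is recognised above that path. If at some state s the vertices u and w
-- can fire, and v can fire after u but neither at s nor after w, then e(w,v) < e(u,v).
-- In the CFG `triangle` this happens cyclically for three vertices v₀, v₁, v₂, so
-- symmetric multiplicities would give e(0,1) < e(1,2) < e(2,0) < e(0,1).

module Submission where

open import Defs
open import Level using (0ℓ)
open import Data.Fin using (Fin; zero; suc; _≟_; _↑ˡ_; _↑ʳ_; splitAt)
open import Data.Fin.Patterns using (0F; 1F; 2F)
open import Data.Fin.Properties using (all?)
open import Data.List using (List; []; _∷_)
open import Data.Nat using (ℕ; zero; suc; _+_; _∸_; _≤_; _<_; z≤n; s≤s; _≤?_)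
open import Data.Nat.Properties as ℕ
  using (≤-refl; ≤-reflexive; ≤-trans; <-≤-trans; <-irrefl; <⇒≱; ≰⇒>; m≤m+n)
open import Data.Product using (Σ; ∃; _×_; _,_; proj₁; proj₂)
open import Data.Sum using (_⊎_; inj₁; inj₂; reduce)
open import Data.Unit using (⊤; tt)
open import Data.Vec using (Vec; []; _∷_; lookup; replicate; tabulate; sum)
open import Data.Vec.Properties using (lookup∘tabulate; tabulate∘lookup; tabulate-cong; ≡-dec)
open import Function using (_∘_; id)
open import Relation.Binary.Bundles using (Poset)
open import Relation.Binary.Construct.Closure.ReflexiveTransitive as Star using (Star; ε; _◅_; _◅◅_)
open import Relation.Binary.PropositionalEquality
  using (_≡_; _≢_; refl; sym; trans; cong; cong₂; subst; subst₂; module ≡-Reasoning)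
open import Relation.Nullary using (¬_; Dec; yes; no; contradiction)
open import Relation.Nullary.Decidable using (from-yes; ¬?; _×-dec_; _→-dec_; _⊎-dec_)

-- Vectors, paths and the effect of one firing.

lookup-ext : ∀ {n} {σ τ : Config n} → (∀ w → lookup σ w ≡ lookup τ w) → σ ≡ τ
lookup-ext {σ = σ} {τ} eq =
  trans (sym (tabulate∘lookup σ)) (trans (tabulate-cong eq) (tabulate∘lookup τ))

sum-zeros : ∀ {n} (f : Fin n → ℕ) → (∀ w → f w ≡ 0) → sum (tabulate f) ≡ 0
sum-zeros {zero}  f eq = refl
sum-zeros {suc n} f eq = cong₂ _+_ (eq zero) (sum-zeros (f ∘ suc) (eq ∘ suc))

Star-split : ∀ {A : Set} {R : A → A → Set} {x z} →
  Star R x z → x ≡ z ⊎ ∃ λ y → R x y × Star R y z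
Star-split ε       = inj₁ refl
Star-split (s ◅ p) = inj₂ (_ , s , p)

module _ {n} (m : Fin n → Fin n → ℕ) where

  -- The placeholder is the local function of `fire`, which has no name outside Defs.
  lookup-fire : ∀ v σ w → lookup (fire m v σ) w ≡ _
  lookup-fire v σ w = lookup∘tabulate _ w

  lookup-fire-≡ : ∀ v σ → lookup (fire m v σ) v ≡ (lookup σ v + m v v) ∸ outdeg m v
  lookup-fire-≡ v σ with v ≟ v | lookup-fire v σ v
  ... | yes _  | eq = eq
  ... | no v≢v | _  = contradiction refl v≢v

  lookup-fire-≢ : ∀ {v w} → v ≢ w → ∀ σ → lookup (fire m v σ) w ≡ lookup σ w + m v w
  lookup-fire-≢ {v} {w} v≢w σ with v ≟ w | lookup-fire v σ w
  ... | yes v≡w | _  = contradiction v≡w v≢w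
  ... | no _    | eq = eq

outdeg-cong : ∀ {n} {m m′ : Fin n → Fin n → ℕ} {v} →
  (∀ w → m v w ≡ m′ v w) → outdeg m v ≡ outdeg m′ v
outdeg-cong eq = cong sum (tabulate-cong eq)

-- Firing `v` reads only row `v` of the multiplicities, so emptying the row of the sink leaves every
-- other firing as it was.
fire-cong : ∀ {n} {m m′ : Fin n → Fin n → ℕ} {v} →
  (∀ w → m v w ≡ m′ v w) → ∀ σ → fire m v σ ≡ fire m′ v σ
fire-cong {m = m} {m′} {v} eq σ = lookup-ext pointwise
  where
  pointwise : ∀ w → lookup (fire m v σ) w ≡ lookup (fire m′ v σ) w
  pointwise w with v ≟ w
  ... | yes refl = trans (lookup-fire-≡ m v σ) (trans
          (cong₂ _∸_ (cong (lookup σ v +_) (eq v)) (outdeg-cong {m = m} {m′} eq))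
          (sym (lookup-fire-≡ m′ v σ)))
  ... | no v≢w   = trans (lookup-fire-≢ m v≢w σ) (trans
          (cong (lookup σ w +_) (eq w))
          (sym (lookup-fire-≢ m′ v≢w σ)))

-- Firing in a fixed CFG: commutation, persistence, minimal steps.

module Game (G : CFG) where
  open CFG G public

  Enabled : Fin n → Config n → Set
  Enabled v σ = 1 ≤ outdeg edges v × outdeg edges v ≤ lookup σ v

  enabled? : ∀ v σ → Dec (Enabled v σ)
  enabled? v σ = (1 ≤? outdeg edges v) ×-dec (outdeg edges v ≤? lookup σ v)

  Fires : Fin n → Config n → Config n → Set
  Fires v σ τ = 1 ≤ outdeg edges v × outdeg edges v ≤ lookup σ v × τ ≡ fire edges v σ

  fires? : ∀ v σ τ → Dec (Fires v σ τ)
  fires? v σ τ = (1 ≤? outdeg edges v) ×-dec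
    ((outdeg edges v ≤? lookup σ v) ×-dec ≡-dec ℕ._≟_ τ (fire edges v σ))

  _⇒*_ : Config n → Config n → Set
  _⇒*_ = Star (CFGStep G)

  lookup-fire-self : ∀ v σ → lookup (fire edges v σ) v ≡ lookup σ v ∸ outdeg edges v
  lookup-fire-self v σ = trans (lookup-fire-≡ edges v σ)
    (cong (_∸ outdeg edges v) (trans (cong (lookup σ v +_) (noLoop v)) (ℕ.+-identityʳ _)))

  lookup-fires : ∀ {v w σ τ} → Fires v σ τ → v ≢ w → lookup τ w ≡ lookup σ w + edges v w
  lookup-fires {σ = σ} (_ , _ , refl) v≢w = lookup-fire-≢ edges v≢w σ

  fires-decreases : ∀ {v σ τ} → Fires v σ τ → lookup τ v < lookup σ v
  fires-decreases {v} {σ} (1≤d , d≤σ , refl) = subst (_< lookup σ v) (sym (lookup-fire-self v σ))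
    (ℕ.∸-monoʳ-< 1≤d d≤σ)

  fires-mono : ∀ {u w σ τ} → Fires u σ τ → u ≢ w → lookup σ w ≤ lookup τ w
  fires-mono f u≢w = subst (_ ≤_) (sym (lookup-fires f u≢w)) (m≤m+n _ _)

  step-≢ : ∀ {σ τ} → CFGStep G σ τ → σ ≢ τ
  step-≢ (_ , f) refl = <-irrefl refl (fires-decreases f)

  -- Only the fired vertex loses chips, so the two configurations determine it.
  fires-label : ∀ {u v σ τ} → Fires u σ τ → Fires v σ τ → u ≡ v
  fires-label {u} {v} f g with u ≟ v
  ... | yes u≡v = u≡v
  ... | no u≢v  = contradiction (fires-mono f u≢v) (<⇒≱ (fires-decreases g))

  fires-enabled : ∀ {u v σ τ} → u ≢ v → Fires u σ τ → Enabled v σ → Enabled v τ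
  fires-enabled u≢v f (1≤d , d≤σ) = 1≤d , ≤-trans d≤σ (fires-mono f u≢v)

  -- Both vertices hold enough chips at `σ`, so neither subtraction truncates and the changes simply
  -- add up.
  fire-comm : ∀ {u v} σ → u ≢ v → Enabled u σ → Enabled v σ →
    fire edges u (fire edges v σ) ≡ fire edges v (fire edges u σ)
  fire-comm {u} {v} σ u≢v (_ , du≤) (_ , dv≤) = lookup-ext pointwise
    where
    open ≡-Reasoning
    first : ∀ {u v} → u ≢ v → outdeg edges u ≤ lookup σ u →
      lookup (fire edges u (fire edges v σ)) u ≡ lookup (fire edges v (fire edges u σ)) u
    first {u} {v} u≢v du≤ = begin
      lookup (fire edges u (fire edges v σ)) u      ≡⟨ lookup-fire-self u _ ⟩
      lookup (fire edges v σ) u ∸ outdeg edges u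
        ≡⟨ cong (_∸ outdeg edges u) (lookup-fire-≢ edges (u≢v ∘ sym) σ) ⟩
      (lookup σ u + edges v u) ∸ outdeg edges u     ≡⟨ ℕ.+-∸-comm (edges v u) du≤ ⟩
      (lookup σ u ∸ outdeg edges u) + edges v u     ≡⟨ cong (_+ edges v u) (lookup-fire-self u σ) ⟨
      lookup (fire edges u σ) u + edges v u         ≡⟨ lookup-fire-≢ edges (u≢v ∘ sym) _ ⟨
      lookup (fire edges v (fire edges u σ)) u      ∎
    other : ∀ {u v w} → u ≢ w → v ≢ w →
      lookup (fire edges u (fire edges v σ)) w ≡ lookup σ w + edges v w + edges u w
    other u≢w v≢w = trans (lookup-fire-≢ edges u≢w _) (cong (_+ _) (lookup-fire-≢ edges v≢w σ))
    pointwise : ∀ w → _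
    pointwise w with u ≟ w | v ≟ w
    ... | yes refl | _        = first u≢v du≤
    ... | no _     | yes refl = sym (first (u≢v ∘ sym) dv≤)
    ... | no u≢w   | no v≢w   = begin
      lookup (fire edges u (fire edges v σ)) w      ≡⟨ other u≢w v≢w ⟩
      lookup σ w + edges v w + edges u w            ≡⟨ ℕ.+-assoc (lookup σ w) _ _ ⟩
      lookup σ w + (edges v w + edges u w)          ≡⟨ cong (lookup σ w +_) (ℕ.+-comm (edges v w) _) ⟩
      lookup σ w + (edges u w + edges v w)          ≡⟨ ℕ.+-assoc (lookup σ w) _ _ ⟨
      lookup σ w + edges u w + edges v w            ≡⟨ other v≢w u≢w ⟨
      lookup (fire edges v (fire edges u σ)) w      ∎

  diamond : ∀ {u v σ τ ω} → u ≢ v → Fires u σ τ → Fires v σ ω → ∃ λ ρ → Fires v τ ρ × Fires u ω ρ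
  diamond {u} {v} {σ} u≢v f@(1≤du , du≤ , refl) g@(1≤dv , dv≤ , refl) =
    _ ,
    (1≤dv , proj₂ (fires-enabled u≢v f (1≤dv , dv≤)) , refl) ,
    (1≤du , proj₂ (fires-enabled (u≢v ∘ sym) g (1≤du , du≤)) ,
      sym (fire-comm σ u≢v (1≤du , du≤) (1≤dv , dv≤)))

  -- Either v is fired on the path (left), or it is not and has only gained chips (right).
  persist : ∀ {v σ τ ω} → Fires v σ τ → σ ⇒* ω →
    τ ⇒* ω ⊎ ∃ λ ρ → Fires v ω ρ × τ ⇒* ρ × lookup σ v ≤ lookup ω v
  persist f ε = inj₂ (_ , f , ε , ≤-refl)
  persist {v} f@(_ , _ , refl) ((u , g@(_ , _ , refl)) ◅ p) with u ≟ v
  ... | yes refl = inj₁ p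
  ... | no u≢v   with diamond u≢v g f
  ...   | _ , f′ , g′ with persist f′ p
  ...     | inj₁ q                   = inj₁ ((u , g′) ◅ q)
  ...     | inj₂ (ρ , f″ , q , σ₁≤ω) =
              inj₂ (ρ , f″ , (u , g′) ◅ q , ≤-trans (fires-mono g u≢v) σ₁≤ω)

  ⇒*-mono : ∀ {w σ τ} → outdeg edges w ≡ 0 → σ ⇒* τ → lookup σ w ≤ lookup τ w
  ⇒*-mono d≡0 ε                          = ≤-refl
  ⇒*-mono d≡0 ((v , f@(1≤d , _)) ◅ p) = ≤-trans
    (fires-mono f (λ { refl → contradiction 1≤d (<⇒≱ (s≤s (≤-reflexive d≡0))) }))
    (⇒*-mono d≡0 p)

  Acyclic : Set
  Acyclic = ∀ {σ τ} → init ⇒* σ → σ ⇒* τ → τ ⇒* σ → σ ≡ τ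

  -- Suppose `u ≢ v` were fired first on a path to `τ`. If `v` is fired later on it, firing `u` at
  -- `τ` closes a cycle; if not, `v` keeps chips that it has lost in `τ`.
  step-minimal : Acyclic → ∀ {σ τ ω} → init ⇒* σ →
    CFGStep G σ τ → CFGStep G σ ω → ω ⇒* τ → ω ≡ τ
  step-minimal acyclic r (v , f) (u , g) p with u ≟ v
  ... | yes refl = trans (proj₂ (proj₂ g)) (sym (proj₂ (proj₂ f)))
  ... | no u≢v   with diamond u≢v g f
  ...   | ρ , f′ , g′ with persist f′ p
  ...     | inj₁ q                = contradiction
              (acyclic (r ◅◅ (v , f) ◅ ε) ((u , g′) ◅ ε) q) (step-≢ (u , g′))
  ...     | inj₂ (_ , _ , _ , ω≤τ) = contradiction
              (≤-trans (fires-mono g u≢v) ω≤τ) (<⇒≱ (fires-decreases f))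

  -- Runs given as lists of vertices are decidable, so facts about a concrete game can be settled by
  -- evaluation.
  Legal : Config n → List (Fin n) → Set
  Legal σ []      = ⊤
  Legal σ (v ∷ l) = Enabled v σ × Legal (fire edges v σ) l

  play : Config n → List (Fin n) → Config n
  play σ []      = σ
  play σ (v ∷ l) = play (fire edges v σ) l

  legal? : ∀ σ l → Dec (Legal σ l)
  legal? σ []      = yes tt
  legal? σ (v ∷ l) = enabled? v σ ×-dec legal? (fire edges v σ) l

  play-reach : ∀ {σ} l → Legal σ l → σ ⇒* play σ l
  play-reach []      _                   = ε
  play-reach (v ∷ l) ((1≤d , d≤σ) , leg) = (v , 1≤d , d≤σ , refl) ◅ play-reach l leg

-- Games whose spaces are isomorphic to one poset.

SpaceIso : CFG → Poset 0ℓ 0ℓ 0ℓ → Set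
SpaceIso G = _≅Space (CFGStep G) (CFG.init G)

module Iso (G : CFG) (P : Poset 0ℓ 0ℓ 0ℓ) (I : SpaceIso G P) where
  open Poset P using (_≈_; module Eq) renaming (Carrier to C; _≤_ to _⊑_)
  open _≅Space I public
  open Game G

  config : C → Config n
  config x = proj₁ (to x)

  reachable : ∀ x → init ⇒* config x
  reachable x = proj₂ (to x)

  config-injective : ∀ {x y} → config x ≡ config y → x ≈ y
  config-injective eq = Eq.trans (Eq.sym (from-to _)) (Eq.trans (from-cong eq) (from-to _))

  config-surjective : ∀ {x σ} → config x ⇒* σ → ∃ λ y → config y ≡ σ
  config-surjective {x} p = from s , to-from s
    where s = _ , reachable x ◅◅ p

  acyclic : Acyclic
  acyclic r p q = trans (sym (to-from s)) (trans (to-cong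
      (Poset.antisym P (to-refl (subst₂ _⇒*_ (sym (to-from s)) (sym (to-from t)) p))
                       (to-refl (subst₂ _⇒*_ (sym (to-from t)) (sym (to-from s)) q))))
      (to-from t))
    where
    s = _ , r
    t = _ , r ◅◅ p

module _ {P : Poset 0ℓ 0ℓ 0ℓ} (G H : CFG) (I : SpaceIso G P) (J : SpaceIso H P) where
  private
    module I = Iso G P I
    module J = Iso H P J

  -- In both spaces the steps are the covering pairs of P.
  step-transfer : ∀ {x y} → CFGStep G (I.config x) (I.config y) → CFGStep H (J.config x) (J.config y)
  step-transfer {x} {y} st with Star-split (J.to-mono (I.to-refl {x} {y} (st ◅ ε)))
  ... | inj₁ eq = contradiction (I.to-cong (J.config-injective eq)) (Game.step-≢ G st)
  ... | inj₂ (ω , st′ , p) with J.config-surjective {x} (st′ ◅ ε)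
  ...   | w , refl with Star-split (I.to-mono (J.to-refl {x} {w} (st′ ◅ ε)))
  ...     | inj₁ eq = contradiction (J.to-cong (I.config-injective eq)) (Game.step-≢ H st′)
  ...     | inj₂ (_ , st″ , q) = subst (CFGStep H _) (J.to-cong w≈y) st′
    where
    w⇒y : Star (CFGStep G) (I.config w) (I.config y)
    w⇒y = I.to-mono (J.to-refl {w} {y} p)
    -- The path in `G` from `x` to `w` starts with a step to something below `y`, which by
    -- minimality is `y` itself.
    y⇒w : Star (CFGStep G) (I.config y) (I.config w)
    y⇒w = subst (λ σ → Star (CFGStep G) σ _)
      (Game.step-minimal G I.acyclic (I.reachable x) st st″ (q ◅◅ w⇒y)) q
    w≈y : Poset._≈_ P w y
    w≈y = Poset.antisym P (I.to-refl w⇒y) (I.to-refl y⇒w)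

-- From sandpiles to chip firing games.

module _ (A : ASM) where
  open ASM A

  sinkless : Fin n → Fin n → ℕ
  sinkless v w with v ≟ sink
  ... | yes _ = 0
  ... | no _  = edges v w

  sinkless-sink : ∀ w → sinkless sink w ≡ 0
  sinkless-sink w with sink ≟ sink
  ... | yes _ = refl
  ... | no ¬p = contradiction refl ¬p

  sinkless-other : ∀ {v} → v ≢ sink → ∀ w → sinkless v w ≡ edges v w
  sinkless-other {v} v≢s w with v ≟ sink
  ... | yes v≡s = contradiction v≡s v≢s
  ... | no _    = refl

  toCFG : CFG
  toCFG = record { n = n ; edges = sinkless ; noLoop = loopless ; init = init }
    where
    loopless : ∀ v → sinkless v v ≡ 0
    loopless v with v ≟ sink
    ... | yes _ = refl
    ... | no _  = noLoop v

  outdeg-≢-sink : ∀ {v} → 1 ≤ outdeg sinkless v → v ≢ sink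
  outdeg-≢-sink 1≤d refl = <-irrefl refl (subst (1 ≤_) (sum-zeros (sinkless sink) sinkless-sink) 1≤d)

  -- Only the row of the sink was emptied, so symmetry survives between the other vertices.
  sinkless-symm : ∀ {v w} → v ≢ sink → w ≢ sink → sinkless v w ≡ sinkless w v
  sinkless-symm v≢s w≢s =
    trans (sinkless-other v≢s _) (trans (symm _ _) (sym (sinkless-other w≢s _)))

  CFGStep⇒ASMStep : ∀ {σ τ} → CFGStep toCFG σ τ → ASMStep A σ τ
  CFGStep⇒ASMStep {σ} (v , 1≤d , d≤σ , refl) = v , v≢s ,
    subst (_≤ lookup σ v) (outdeg-cong {m = sinkless} {edges} (sinkless-other v≢s)) d≤σ ,
    fire-cong {m = sinkless} {edges} (sinkless-other v≢s) σ
    where v≢s = outdeg-≢-sink 1≤d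

  -- An isolated vertex other than the sink could be fired for ever.
  outdeg-positive : Convergent (ASMStep A) init → ∀ {v} → v ≢ sink → 1 ≤ outdeg edges v
  outdeg-positive (σ , _ , final) {v} v≢s with 1 ≤? outdeg edges v
  ... | yes 1≤d = 1≤d
  ... | no ¬1≤d = contradiction
    (v , v≢s , ≤-trans (ℕ.≤-pred (≰⇒> ¬1≤d)) z≤n , refl) (final _)

  ASMStep⇒CFGStep : Convergent (ASMStep A) init → ∀ {σ τ} → ASMStep A σ τ → CFGStep toCFG σ τ
  ASMStep⇒CFGStep conv {σ} (v , v≢s , d≤σ , refl) = v ,
    subst (1 ≤_) d≡ (outdeg-positive conv v≢s) ,
    subst (_≤ lookup σ v) d≡ d≤σ ,
    sym (fire-cong {m = sinkless} {edges} (sinkless-other v≢s) σ)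
    where d≡ = sym (outdeg-cong {m = sinkless} {edges} (sinkless-other v≢s))

module _ {n} {S T : Config n → Config n → Set} {σ₀ : Config n}
  (f : ∀ {σ τ} → S σ τ → T σ τ) (g : ∀ {σ τ} → T σ τ → S σ τ) where

  Convergent-map : Convergent S σ₀ → Convergent T σ₀
  Convergent-map (σ , r , final) = σ , Star.map f r , λ τ → final τ ∘ g

  ≅Space-map : ∀ {P} → _≅Space S σ₀ P → _≅Space T σ₀ P
  ≅Space-map {P} I = record
    { to        = λ x → proj₁ (I.to x) , Star.map f (proj₂ (I.to x))
    ; from      = λ (σ , r) → I.from (σ , Star.map g r)
    ; to-cong   = I.to-cong
    ; from-cong = I.from-cong
    ; from-to   = λ x → P.Eq.trans (I.from-cong refl) (I.from-to x)
    ; to-from   = λ (σ , r) → I.to-from (σ , Star.map g r)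
    ; to-mono   = Star.map f ∘ I.to-mono
    ; to-refl   = I.to-refl ∘ Star.map g
    }
    where
    module I = _≅Space I
    module P = Poset P

-- This gives the inclusion, and it lets the strictness argument compare two CFGs.
InLASM⇒toCFG : ∀ {P} → ((A , _) : InLASM P) →
  Convergent (CFGStep (toCFG A)) (ASM.init A) × SpaceIso (toCFG A) P
InLASM⇒toCFG (A , conv , I) = Convergent-map f g conv , ≅Space-map f g I
  where
  f : ∀ {σ τ} → ASMStep A σ τ → CFGStep (toCFG A) σ τ
  f = ASMStep⇒CFGStep A conv
  g : ∀ {σ τ} → CFGStep (toCFG A) σ τ → ASMStep A σ τ
  g = CFGStep⇒ASMStep A

-- Spaces as posets, and games with counters.

module _ (G : CFG)
  (antisym : ∀ {σ τ} → Star (CFGStep G) σ τ → Star (CFGStep G) τ σ → σ ≡ τ) where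
  open CFG G using (init)

  spacePoset : Poset 0ℓ 0ℓ 0ℓ
  spacePoset = record
    { Carrier = Space (CFGStep G) init
    ; _≈_ = _≈S_ (CFGStep G) init
    ; _≤_ = _≤S_ (CFGStep G) init
    ; isPartialOrder = record
      { isPreorder = record
        { isEquivalence = record { refl = refl ; sym = sym ; trans = trans }
        ; reflexive     = λ { refl → ε }
        ; trans         = _◅◅_
        }
      ; antisym = antisym
      }
    }

  space-iso : SpaceIso G spacePoset
  space-iso = record
    { to = id ; from = id ; to-cong = id ; from-cong = id
    ; from-to = λ _ → refl ; to-from = λ _ → refl ; to-mono = id ; to-refl = id
    }

-- The counters make it visible in the order which vertices have fired.
record Counted (G : CFG) : Set where
  open CFG G
  field
    counter   : Fin n → Fin n
    terminal  : ∀ g → outdeg edges (counter g) ≡ 0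
    gains     : ∀ g → 1 ≤ outdeg edges g → 1 ≤ edges g (counter g)
    exclusive : ∀ g h → 1 ≤ outdeg edges g → 1 ≤ edges h (counter g) → h ≡ g

module CountedGame {G : CFG} (counted : Counted G) where
  open Game G
  open Counted counted

  S : Set
  S = Space (CFGStep G) init

  count : Config n → Fin n → ℕ
  count σ g = lookup σ (counter g)

  count-fires : ∀ g {h σ τ} → Fires h σ τ → count τ g ≡ count σ g + edges h (counter g)
  count-fires g f@(1≤d , _) =
    lookup-fires f λ { refl → <⇒≱ 1≤d (≤-reflexive (terminal g)) }

  count-mono : ∀ g {σ τ} → σ ⇒* τ → count σ g ≤ count τ g
  count-mono g = ⇒*-mono (terminal g)

  count-increases : ∀ {g σ τ} → Fires g σ τ → count σ g < count τ g
  count-increases {g} {σ} f@(1≤d , _) =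
    subst (count σ g <_) (sym (count-fires g f)) (ℕ.m<m+n (count σ g) (gains g 1≤d))

  -- A firing raises its own counter and no step lowers a counter, so no path returns.
  ⇒*-antisym : ∀ {σ τ} → σ ⇒* τ → τ ⇒* σ → σ ≡ τ
  ⇒*-antisym ε             q = refl
  ⇒*-antisym ((g , f) ◅ p) q = contradiction (count-mono g (p ◅◅ q)) (<⇒≱ (count-increases f))

  poset : Poset 0ℓ 0ℓ 0ℓ
  poset = spacePoset G ⇒*-antisym

  poset-iso : SpaceIso G poset
  poset-iso = space-iso G ⇒*-antisym

  -- As firing `g` raises its counter, equal counts mean that no path from `x` to `z` fires `g`.
  Still : Fin n → S → S → Set
  Still g x z = proj₁ x ⇒* proj₁ z × count (proj₁ z) g ≡ count (proj₁ x) g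

  -- At base, t becomes available after u but not after w. In an isomorphic game, t-shared
  -- makes the firings of t at left and at top firings of one vertex, and t-blocked ensures
  -- that this vertex is not fired at right.
  record Favours (top : S) (t u w : Fin n) : Set where
    field
      base left right : S
      u-fires   : Fires u (proj₁ base) (proj₁ left)
      w-fires   : Fires w (proj₁ base) (proj₁ right)
      u-still   : Still u base top
      w-still   : Still w base top
      t-enabled : Enabled t (proj₁ left)
      t-shared  : ∃ λ z → Still t left z × Still t top z
      t-blocked : ∀ g → Enabled g (proj₁ right) →
        g ≢ t × ∃ λ z → Still g right z × (Still t left z ⊎ Still t top z)

-- Matching the vertices of two games with isomorphic spaces.

module Labelling {G H : CFG} (counted : Counted G)
  (J : SpaceIso H (CountedGame.poset counted)) where
  private
    module G = Game G
    module H = Game H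
    module J = Iso H (CountedGame.poset counted) J
  open Counted counted
  open CountedGame counted
  open J using (config)

  -- Vertices are matched at one state at a time: both firings at `x` lead to the same poset element
  -- `y`. Agreement between states has to be proved.
  Label : Fin H.n → Fin G.n → S → Set
  Label u g x = ∃ λ y → G.Fires g (proj₁ x) (proj₁ y) × H.Fires u (config x) (config y)

  label-fires : ∀ {u g x y} → Label u g x → G.Fires g (proj₁ x) (proj₁ y) →
    H.Fires u (config x) (config y)
  label-fires {x = x} (z , (_ , _ , refl) , f) (_ , _ , refl) =
    subst (H.Fires _ (config x)) (J.to-cong refl) f

  label-exists : ∀ {g} x → G.Enabled g (proj₁ x) → ∃ λ u → Label u g x
  label-exists {g} x (1≤d , d≤) =
    let f = 1≤d , d≤ , refl
        y = _ , proj₂ x ◅◅ (g , f) ◅ ε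
        (u , f′) = step-transfer G H poset-iso J {x} {y} (g , f)
    in u , y , f , f′

  enabled-label : ∀ {u} x → H.Enabled u (config x) → ∃ λ g → G.Enabled g (proj₁ x) × Label u g x
  enabled-label {u} x (1≤d , d≤) with J.config-surjective {x} ((u , 1≤d , d≤ , refl) ◅ ε)
  ... | y , eq with step-transfer H G J poset-iso {x} {y} (u , 1≤d , d≤ , eq)
  ...   | g , f@(1≤d′ , d′≤ , _) = g , (1≤d′ , d′≤) , y , f , 1≤d , d≤ , eq

  label-unique : ∀ {u w g} x → Label u g x → Label w g x → u ≡ w
  label-unique x l (y , f , f′) = H.fires-label (label-fires {x = x} {y} l f) f′

  label-injective : ∀ {u g h} x → Label u g x → Label u h x → g ≡ h
  label-injective x (y , f , (_ , _ , eq)) (y′ , f′ , (_ , _ , eq′)) =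
    G.fires-label f (subst (G.Fires _ (proj₁ x)) (sym y≡y′) f′)
    where
    y≡y′ : proj₁ y ≡ proj₁ y′
    y≡y′ = J.config-injective {y} {y′} (trans eq (sym eq′))

  -- If `u` were fired on the way, `z` would lie above `y`, where the counter of `g` is already too
  -- high. So `u` can still fire at `z`, and the result lies above `y`.
  label-lift : ∀ {u g} x z → Label u g x → proj₁ x G.⇒* proj₁ z →
    count (proj₁ z) g ≡ count (proj₁ x) g → Label u g z
  label-lift {u} {g} x z (y , f , f′) x⇒z same with H.persist f′ (J.to-mono {x} {z} x⇒z)
  ... | inj₁ y⇒z = contradiction (count-mono g (J.to-refl {y} {z} y⇒z))
          (<⇒≱ (subst (_< count (proj₁ y) g) (sym same) (count-increases f)))
  ... | inj₂ (ρ , f″ , y⇒ρ , _) with J.config-surjective {z} ((u , f″) ◅ ε)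
  ...   | t , refl with step-transfer H G J poset-iso {z} {t} (u , f″)
  ...     | h , k =
    t , subst (λ h → G.Fires h (proj₁ z) (proj₁ t)) (exclusive g h (proj₁ f) gained) k , f″
    where
    -- The step from `z` ends above `y`, so it raises the counter of `g`, and only `g` feeds that
    -- counter.
    gained : 1 ≤ G.edges h (counter g)
    gained = ℕ.+-cancelˡ-< (count (proj₁ z) g) 0 _ (subst₂ _<_
      (trans (sym same) (sym (ℕ.+-identityʳ _))) (count-fires g k)
      (<-≤-trans (count-increases f) (count-mono g (J.to-refl {y} {t} y⇒ρ))))

  -- At `z` the vertex `t` holds less than its outdegree, at `y` at least that much; each amount is
  -- the one at `x` plus the edges from the vertex fired.
  label-weight : ∀ {u w t g h k} x y z → Label u g x → Label w h x → Label t k y →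
    G.Fires g (proj₁ x) (proj₁ y) → G.Fires h (proj₁ x) (proj₁ z) →
    ¬ H.Enabled t (config z) → u ≢ t → w ≢ t → H.edges w t < H.edges u t
  label-weight {t = t} x y z lu lw (_ , _ , 1≤d , d≤ , _) fy fz ¬en u≢t w≢t =
    ℕ.+-cancelˡ-< (lookup (config x) t) _ _ (subst₂ _<_
      (H.lookup-fires (label-fires {x = x} {z} lw fz) w≢t)
      (H.lookup-fires (label-fires {x = x} {y} lu fy) u≢t)
      (<-≤-trans (≰⇒> λ d≤z → ¬en (1≤d , d≤z)) d≤))

  -- Labels lift only upwards, so the labels at `x` and at `top` are compared in a state `z` above
  -- both.
  label-from-top : ∀ {u g} x z top → Label u g top → G.Enabled g (proj₁ x) →
    Still g x z → Still g top z → Label u g x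
  label-from-top {g = g} x z top l en (x⇒z , x≡z) (top⇒z , top≡z) with label-exists x en
  ... | w , l′ = subst (λ w → Label w g x)
    (label-unique z (label-lift x z l′ x⇒z x≡z) (label-lift top z l top⇒z top≡z)) l′

  favours-< : ∀ {top t u w ℓt ℓu ℓw} → Favours top t u w → u ≢ t → w ≢ t →
    Label ℓt t top → Label ℓu u top → Label ℓw w top → H.edges ℓw ℓt < H.edges ℓu ℓt
  favours-< {top} {t} {u} {w} {ℓt} {ℓu} {ℓw} fav u≢t w≢t lt lu lw =
    label-weight base left right
      (label-from-top base top top lu (enabled u-fires) u-still (ε , refl))
      (label-from-top base top top lw (enabled w-fires) w-still (ε , refl))
      t-left u-fires w-fires blocked
      (λ eq → u≢t (label-injective top lu (subst (λ ℓ → Label ℓ t top) (sym eq) lt)))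
      (λ eq → w≢t (label-injective top lw (subst (λ ℓ → Label ℓ t top) (sym eq) lt)))
    where
    open Favours fav
    enabled : ∀ {g σ τ} → G.Fires g σ τ → G.Enabled g σ
    enabled (1≤d , d≤ , _) = 1≤d , d≤
    t-left : Label ℓt t left
    t-left = let z , still , still′ = t-shared in
      label-from-top left z top lt t-enabled still still′
    t-above : ∀ z → Still t left z ⊎ Still t top z → Label ℓt t z
    t-above z (inj₁ (p , same)) = label-lift left z t-left p same
    t-above z (inj₂ (p , same)) = label-lift top z lt p same
    -- If `ℓt` could fire at `right`, it would be the label of some enabled `g` there; at `z` both
    -- `g` and `t` would carry it, forcing `g ≡ t`.
    blocked : ¬ H.Enabled ℓt (config right)
    blocked en with enabled-label right en
    ... | g , g-en , lg with t-blocked g g-en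
    ...   | g≢t , z , (p , same) , t-still =
      g≢t (label-injective z (label-lift right z lg p same) (t-above z t-still))

-- A cycle of preferences excludes sandpiles.

module _ {G : CFG} (counted : Counted G) where
  open CountedGame counted
  open Game G using (Enabled)

  -- All labels are taken at the common state `top`, so that the three inequalities concern the same
  -- three vertices.
  favours-cycle : ∀ top {t u w} → t ≢ u → u ≢ w → w ≢ t →
    Enabled t (proj₁ top) → Enabled u (proj₁ top) → Enabled w (proj₁ top) →
    Favours top t u w → Favours top u w t → Favours top w t u → ¬ InLASM poset
  favours-cycle top {t} {u} {w} t≢u u≢w w≢t t-en u-en w-en ft fu fw inLASM@(A , _) =
    <-irrefl refl (begin-strict
      e ℓu ℓt   ≡⟨ symmetric lu lt ⟩
      e ℓt ℓu   <⟨ favours-< fu (u≢w ∘ sym) t≢u lu lw lt ⟩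
      e ℓw ℓu   ≡⟨ symmetric lw lu ⟩
      e ℓu ℓw   <⟨ favours-< fw (w≢t ∘ sym) u≢w lw lt lu ⟩
      e ℓt ℓw   ≡⟨ symmetric lt lw ⟩
      e ℓw ℓt   <⟨ favours-< ft (t≢u ∘ sym) w≢t lt lu lw ⟩
      e ℓu ℓt   ∎)
    where
    open ℕ.≤-Reasoning
    J : SpaceIso (toCFG A) poset
    J = proj₂ (InLASM⇒toCFG inLASM)
    open Labelling {H = toCFG A} counted J
    e = CFG.edges (toCFG A)
    ℓt = proj₁ (label-exists top t-en)
    ℓu = proj₁ (label-exists top u-en)
    ℓw = proj₁ (label-exists top w-en)
    lt = proj₂ (label-exists top t-en)
    lu = proj₂ (label-exists top u-en)
    lw = proj₂ (label-exists top w-en)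
    -- A label can be fired at `top`, hence it is not the sink.
    symmetric : ∀ {ℓ ℓ′ g h} → Label ℓ g top → Label ℓ′ h top → e ℓ ℓ′ ≡ e ℓ′ ℓ
    symmetric {ℓ} {ℓ′} (_ , _ , 1≤d , _) (_ , _ , 1≤d′ , _) =
      sinkless-symm A (outdeg-≢-sink A {ℓ} 1≤d) (outdeg-≢-sink A {ℓ′} 1≤d′)

-- The triangle game and its cycle of preferences.

-- Vertices 0–2 are a₀, a₁, a₂, vertices 3–5 are v₀, v₁, v₂, and vertex 6 + g counts the
-- firings of g < 6. Each vᵢ lacks one chip, which it can get from aᵢ or from vᵢ₊₁.
triangle : CFG
triangle = record
  { n      = 12
  ; edges  = λ g h → lookup (lookup table g) h
  ; noLoop = from-yes (all? λ g → lookup (lookup table g) g ℕ.≟ 0)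
  ; init   = 2 ∷ 2 ∷ 2 ∷ 1 ∷ 1 ∷ 1 ∷ replicate 6 0
  }
  where
  table : Vec (Vec ℕ 12) 12
  table =
      (0 ∷ 0 ∷ 0 ∷ 1 ∷ 0 ∷ 0 ∷ 1 ∷ 0 ∷ 0 ∷ 0 ∷ 0 ∷ 0 ∷ [])
    ∷ (0 ∷ 0 ∷ 0 ∷ 0 ∷ 1 ∷ 0 ∷ 0 ∷ 1 ∷ 0 ∷ 0 ∷ 0 ∷ 0 ∷ [])
    ∷ (0 ∷ 0 ∷ 0 ∷ 0 ∷ 0 ∷ 1 ∷ 0 ∷ 0 ∷ 1 ∷ 0 ∷ 0 ∷ 0 ∷ [])
    ∷ (0 ∷ 0 ∷ 0 ∷ 0 ∷ 0 ∷ 1 ∷ 0 ∷ 0 ∷ 0 ∷ 1 ∷ 0 ∷ 0 ∷ [])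
    ∷ (0 ∷ 0 ∷ 0 ∷ 1 ∷ 0 ∷ 0 ∷ 0 ∷ 0 ∷ 0 ∷ 0 ∷ 1 ∷ 0 ∷ [])
    ∷ (0 ∷ 0 ∷ 0 ∷ 0 ∷ 1 ∷ 0 ∷ 0 ∷ 0 ∷ 0 ∷ 0 ∷ 0 ∷ 1 ∷ [])
    ∷ replicate 6 (replicate 12 0)

module T = Game triangle

triangle-counted : Counted triangle
triangle-counted = record
  { counter   = counter
  ; terminal  = from-yes (all? λ g → outdeg T.edges (counter g) ℕ.≟ 0)
  ; gains     = from-yes (all? λ g →
      (1 ≤? outdeg T.edges g) →-dec (1 ≤? T.edges g (counter g)))
  ; exclusive = from-yes (all? λ g → all? λ h →
      (1 ≤? outdeg T.edges g) →-dec ((1 ≤? T.edges h (counter g)) →-dec (h ≟ g)))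
  }
  where
  counter : Fin 12 → Fin 12
  -- Both `g` and `6 + g` go to `6 + g`: a counter vertex is taken as its own counter, which makes
  -- the function total.
  counter g = 6 ↑ʳ reduce (splitAt 6 g)

open CountedGame triangle-counted
  using (S; count; Favours) renaming (poset to trianglePoset; poset-iso to triangle-iso)

a v : Fin 3 → Fin 12
a i = i ↑ˡ 9
v i = 3 ↑ʳ (i ↑ˡ 6)

triangle-convergent : Convergent (CFGStep triangle) T.init
triangle-convergent = T.play T.init moves , T.play-reach moves (from-yes (T.legal? T.init moves)) ,
  λ { τ (g , 1≤d , d≤ , _) → final g (1≤d , d≤) }
  where
  moves : List (Fin 12)
  moves = a 0F ∷ a 1F ∷ a 2F ∷ v 0F ∷ v 1F ∷ v 2F ∷ []
  final : ∀ g → ¬ T.Enabled g (T.play T.init moves)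
  final = from-yes (all? λ g → ¬? (T.enabled? g (T.play T.init moves)))

_⁺ : Fin 3 → Fin 3
0F ⁺ = 1F
1F ⁺ = 2F
2F ⁺ = 0F

-- Opaque, so that the type checker does not evaluate games that depend on a variable.
opaque
  after : List (Fin 12) → Config 12
  after = T.play T.init

  StillBy : List (Fin 12) → Fin 12 → Config 12 → Config 12 → Set
  StillBy l g σ τ = (T.Legal σ l × T.play σ l ≡ τ) × count τ g ≡ count σ g

  stillBy? : ∀ l g σ τ → Dec (StillBy l g σ τ)
  stillBy? l g σ τ = (T.legal? σ l ×-dec ≡-dec ℕ._≟_ _ _) ×-dec (_ ℕ.≟ _)

  still : ∀ {l g σ τ} → StillBy l g σ τ → σ T.⇒* τ × count τ g ≡ count σ g
  still {l} ((legal , refl) , same) = T.play-reach l legal , same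

-- At `base i` the vertex `v i` is one chip short, as `a i` has not fired. Firing `v (i ⁺)` supplies
-- the chip, firing `v (i ⁺ ⁺)` does not; `both i` joins the two branches.
base left right both : Fin 3 → List (Fin 12)
base  i = a (i ⁺) ∷ a (i ⁺ ⁺) ∷ []
left  i = a (i ⁺) ∷ a (i ⁺ ⁺) ∷ v (i ⁺) ∷ []
right i = a (i ⁺) ∷ a (i ⁺ ⁺) ∷ v (i ⁺ ⁺) ∷ []
both  i = a (i ⁺) ∷ a (i ⁺ ⁺) ∷ v (i ⁺) ∷ v (i ⁺ ⁺) ∷ []

top : List (Fin 12)
top = a 0F ∷ a 1F ∷ a 2F ∷ []

top▷ : Fin 3 → List (Fin 12)
top▷ i = a 0F ∷ a 1F ∷ a 2F ∷ v i ∷ []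

opaque
  unfolding after

  after-reachable : ∀ l → T.Legal T.init l → T.init T.⇒* after l
  after-reachable = T.play-reach

  base-legal : ∀ i → T.Legal T.init (base i)
  base-legal = from-yes (all? λ i → T.legal? T.init (base i))

  left-legal : ∀ i → T.Legal T.init (left i)
  left-legal = from-yes (all? λ i → T.legal? T.init (left i))

  right-legal : ∀ i → T.Legal T.init (right i)
  right-legal = from-yes (all? λ i → T.legal? T.init (right i))

  both-legal : ∀ i → T.Legal T.init (both i)
  both-legal = from-yes (all? λ i → T.legal? T.init (both i))

  top-legal : T.Legal T.init top
  top-legal = from-yes (T.legal? T.init top)

  top▷-legal : ∀ i → T.Legal T.init (top▷ i)
  top▷-legal = from-yes (all? λ i → T.legal? T.init (top▷ i))

  left-fires : ∀ i → T.Fires (v (i ⁺)) (after (base i)) (after (left i))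
  left-fires = from-yes (all? λ i → T.fires? (v (i ⁺)) (after (base i)) (after (left i)))

  right-fires : ∀ i → T.Fires (v (i ⁺ ⁺)) (after (base i)) (after (right i))
  right-fires = from-yes (all? λ i → T.fires? (v (i ⁺ ⁺)) (after (base i)) (after (right i)))

  base-top⁺ : ∀ i → StillBy (a i ∷ []) (v (i ⁺)) (after (base i)) (after top)
  base-top⁺ = from-yes (all? λ i → stillBy? (a i ∷ []) (v (i ⁺)) (after (base i)) (after top))

  base-top⁺⁺ : ∀ i → StillBy (a i ∷ []) (v (i ⁺ ⁺)) (after (base i)) (after top)
  base-top⁺⁺ = from-yes (all? λ i → stillBy? (a i ∷ []) (v (i ⁺ ⁺)) (after (base i)) (after top))

  left-top▷ : ∀ i → StillBy (a i ∷ []) (v i) (after (left i)) (after (top▷ (i ⁺)))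
  left-top▷ = from-yes (all? λ i → stillBy? (a i ∷ []) (v i) (after (left i)) (after (top▷ (i ⁺))))

  left-both : ∀ i → StillBy (v (i ⁺ ⁺) ∷ []) (v i) (after (left i)) (after (both i))
  left-both = from-yes (all? λ i → stillBy? (v (i ⁺ ⁺) ∷ []) (v i) (after (left i)) (after (both i)))

  right-top▷ : ∀ i → StillBy (a i ∷ []) (v (i ⁺)) (after (right i)) (after (top▷ (i ⁺ ⁺)))
  right-top▷ = from-yes (all? λ i →
    stillBy? (a i ∷ []) (v (i ⁺)) (after (right i)) (after (top▷ (i ⁺ ⁺))))

  right-both : ∀ i → StillBy (v (i ⁺) ∷ []) (a i) (after (right i)) (after (both i))
  right-both = from-yes (all? λ i → stillBy? (v (i ⁺) ∷ []) (a i) (after (right i)) (after (both i)))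

  top-top▷ : ∀ i j → i ≢ j → StillBy (v j ∷ []) (v i) (after top) (after (top▷ j))
  top-top▷ = from-yes (all? λ i → all? λ j →
    ¬? (i ≟ j) →-dec stillBy? (v j ∷ []) (v i) (after top) (after (top▷ j)))

  top-enabled : ∀ i → T.Enabled (v i) (after top)
  top-enabled = from-yes (all? λ i → T.enabled? (v i) (after top))

  left-enabled : ∀ i → T.Enabled (v i) (after (left i))
  left-enabled = from-yes (all? λ i → T.enabled? (v i) (after (left i)))

  -- `v i` is absent here: `a i` has not fired, and `v (i ⁺ ⁺)` sends its chip to `v (i ⁺)`.
  right-enabled : ∀ i g → T.Enabled g (after (right i)) → g ≡ v (i ⁺) ⊎ g ≡ a i
  right-enabled = from-yes (all? λ i → all? λ g →
    T.enabled? g (after (right i)) →-dec ((g ≟ v (i ⁺)) ⊎-dec (g ≟ a i)))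

⁺-≢ : ∀ i → i ≢ i ⁺
⁺-≢ = from-yes (all? λ i → ¬? (i ≟ i ⁺))

⁺⁺-≢ : ∀ i → i ≢ i ⁺ ⁺
⁺⁺-≢ = from-yes (all? λ i → ¬? (i ≟ i ⁺ ⁺))

v-≢ : ∀ i → v (i ⁺) ≢ v i
v-≢ = from-yes (all? λ i → ¬? (v (i ⁺) ≟ v i))

a-≢-v : ∀ i → a i ≢ v i
a-≢-v = from-yes (all? λ i → ¬? (a i ≟ v i))

state : ∀ l → T.Legal T.init l → S
state l legal = after l , after-reachable l legal

top-state : S
top-state = state top top-legal

favours : ∀ i → Favours top-state (v i) (v (i ⁺)) (v (i ⁺ ⁺))
favours i = record
  { base      = state (base i) (base-legal i)
  ; left      = state (left i) (left-legal i)
  ; right     = state (right i) (right-legal i)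
  ; u-fires   = left-fires i
  ; w-fires   = right-fires i
  ; u-still   = still (base-top⁺ i)
  ; w-still   = still (base-top⁺⁺ i)
  ; t-enabled = left-enabled i
  -- Firing `a i` after `left i` and firing `v (i ⁺)` after `top` give the same state, with `v i`
  -- still unfired.
  ; t-shared  = state (top▷ (i ⁺)) (top▷-legal (i ⁺)) , still (left-top▷ i) ,
                still (top-top▷ i (i ⁺) (⁺-≢ i))
  ; t-blocked = blocked
  }
  where
  blocked : ∀ g → T.Enabled g (after (right i)) → _
  blocked g en with right-enabled i g en
  -- This state lies above `right i` and above `top`, with `v (i ⁺)` and `v i` both unfired.
  ... | inj₁ refl = v-≢ i , state (top▷ (i ⁺ ⁺)) (top▷-legal (i ⁺ ⁺)) ,
          still (right-top▷ i) , inj₂ (still (top-top▷ i (i ⁺ ⁺) (⁺⁺-≢ i)))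
  -- `a i` has been fired at `top`, so this comparison is made above `left i` instead.
  ... | inj₂ refl = a-≢-v i , state (both i) (both-legal i) ,
          still (right-both i) , inj₁ (still (left-both i))

triangle-∉-LASM : ¬ InLASM trianglePoset
triangle-∉-LASM = favours-cycle triangle-counted top-state (λ ()) (λ ()) (λ ())
  (top-enabled 0F) (top-enabled 1F) (top-enabled 2F) (favours 0F) (favours 1F) (favours 2F)

theorem6 : ((P : Poset 0ℓ 0ℓ 0ℓ) → InLASM P → InLCFG P)
    × Σ (Poset 0ℓ 0ℓ 0ℓ) (λ P → InLCFG P × ¬ InLASM P)
theorem6 = (λ P inLASM → toCFG (proj₁ inLASM) , InLASM⇒toCFG inLASM)
  , trianglePoset , (triangle , triangle-convergent , triangle-iso) , triangle-∉-LASM
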